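{- Let $F_0(u)$ be a polynomial with non-negative coefficients and let $Q=Q(\alpha_0,\alpha_1,z,u)$ be a polynomial in $\alpha_0,\alpha_1,z,u$ with non-negative coefficients that depends (at least) on $\alpha_1$, that is, $Q_{\alpha_1}\ne 0$. Let $M(z,u)$ be the power series solution of $$M(z,u) = F_0(u) + z\, Q\left(M(z,u), \frac{M(z,u)-M(z,0)}{u}, z, u\right).$$ Furthermore assume that $Q$ is not linear in $\alpha_0$ and $\alpha_1$, that is, $Q_{\alpha_0\alpha_0}\ne 0$ or $Q_{\alpha_0\alpha_1}\ne 0$ or $Q_{\alpha_1\alpha_1}\ne 0$. Let $f(z),u(z),w(z)$ be the power series solution of the system of equations $$f(z) = F_0(u(z)) + zQ(f(z),w(z),z,u(z)),$$ $$u(z) = z\,u(z)\,Q_{\alpha_0}(f(z),w(z),z,u(z)) + z\,Q_{\alpha_1}(f(z),w(z),z,u(z)),$$ $$w(z) = F_0'(u(z)) + z\,Q_u(f(z),w(z),z,u(z)) + z\,w(z)\,Q_{\alpha_0}(f(z),w(z),z,u(z)),$$ with $f(0)=F_0(0)$, $u(0)=0$, $w(0)=F_0'(0)$. Then $$M(z,0) = f(z)-w(z)u(z).$$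
   Context: Subscripts of $Q$ denote partial derivatives (e.g. $Q_{\alpha_0\alpha_1}=\partial^2Q/\partial\alpha_0\partial\alpha_1$), and conditions such as $Q_{\alpha_1}\neq 0$ mean that the derivative is not identically zero as a polynomial. The variable $u$ is called a catalytic variable. The functional equation has a unique power series solution $M(z,u)$ (a formal power series in $z$ whose coefficients are polynomials in $u$), and the system has a unique power series solution $(f,u,w)$ with the given initial values. -}

module Defs where

open import Algebra.Bundles using (CommutativeRing; RawRing)
import Algebra.Definitions.RawMonoid as RawMonoidOps
open import Data.Fin.Base using (Fin; zero; suc; toℕ)
open import Data.List.Base using (List; []; _∷_; drop; map)
open import Data.Nat.Base using (ℕ; zero; suc; _∸_)
open import Data.Sum.Base using (_⊎_)
open import Data.Vec.Base using (Vec; []; _∷_)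
open import Level using (Level; _⊔_) renaming (suc to lsuc)
open import Relation.Binary.Core using (Rel)
open import Relation.Binary.Structures using (IsPartialOrder)
open import Relation.Nullary.Negation.Core using (¬_)

private
  variable
    a c ℓ ℓ₁ ℓ₂ : Level

-- The coefficients.  ℤ, ℚ and ℝ are instances; the order is only required to
-- be partial so that ℝ is an instance constructively as well.  Since 0 ≤ 1 and
-- 0 ≉ 1, the characteristic is zero, and no nonzero a ≥ 0 is a torsion element.

record OrderedCommutativeRing c ℓ₁ ℓ₂ : Set (lsuc (c ⊔ ℓ₁ ⊔ ℓ₂)) where
  infix 4 _≤_
  field
    commutativeRing : CommutativeRing c ℓ₁
  open CommutativeRing commutativeRing public
  field
    _≤_            : Rel Carrier ℓ₂
    isPartialOrder : IsPartialOrder _≈_ _≤_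
    +-mono-≤       : ∀ {x y u v} → x ≤ y → u ≤ v → x + u ≤ y + v
    *-nonNegative  : ∀ {x y} → 0# ≤ x → 0# ≤ y → 0# ≤ x * y
    0≤1            : 0# ≤ 1#
    0≉1            : ¬ (0# ≈ 1#)

-- Coefficient lists with the constant
-- coefficient first.  Trailing zeros are allowed and ignored by ≈.

module Polynomial (A : RawRing c ℓ) where
  open RawRing A
  open RawMonoidOps +-rawMonoid using () renaming (_×_ to _·_)

  Poly : Set c
  Poly = List Carrier

  coeff : Poly → ℕ → Carrier
  coeff []      _       = 0#
  coeff (a ∷ _) zero    = a
  coeff (_ ∷ p) (suc i) = coeff p i

  const : Carrier → Poly
  const a = a ∷ []

  var : Poly
  var = 0# ∷ 1# ∷ []

  add : Poly → Poly → Poly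
  add []      q       = q
  add (a ∷ p) []      = a ∷ p
  add (a ∷ p) (b ∷ q) = a + b ∷ add p q

  mul : Poly → Poly → Poly
  mul []      q = []
  mul (a ∷ p) q = add (map (a *_) q) (0# ∷ mul p q)

  ring : RawRing c ℓ
  ring = record
    { Carrier = Poly
    ; _≈_     = λ p q → ∀ i → coeff p i ≈ coeff q i
    ; _+_     = add
    ; _*_     = mul
    ; -_      = map (-_)
    ; 0#      = []
    ; 1#      = const 1#
    }

  derivative : Poly → Poly
  derivative []      = []
  derivative (_ ∷ p) = go 1 p
    where
    go : ℕ → Poly → Poly
    go k []      = []
    go k (a ∷ p) = k · a ∷ go (suc k) p

  -- The exact quotient by the variable of a polynomial whose constant
  -- coefficient is zero.
  divideByVar : Poly → Poly
  divideByVar = drop 1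

-- Value at x ∈ S of a polynomial whose coefficients are mapped to S by ι.

module _ {A : Set a} (S : RawRing c ℓ) (ι : A → RawRing.Carrier S) where
  open RawRing S

  evaluate : List A → Carrier → Carrier
  evaluate []      x = 0#
  evaluate (a ∷ p) x = ι a + x * evaluate p x

module PowerSeries (A : RawRing c ℓ) where
  open RawRing A
  open RawMonoidOps +-rawMonoid using (sum)

  Series : Set c
  Series = ℕ → Carrier

  const : Carrier → Series
  const a zero    = a
  const a (suc _) = 0#

  var : Series
  var 1 = 1#
  var _ = 0#

  ring : RawRing c ℓ
  ring = record
    { Carrier = Series
    ; _≈_     = λ f g → ∀ n → f n ≈ g n
    ; _+_     = λ f g n → f n + g n
    ; _*_     = λ f g n → sum {suc n} (λ i → f (toℕ i) * g (n ∸ toℕ i))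
    ; -_      = λ f n → - f n
    ; 0#      = const 0#
    ; 1#      = const 1#
    }

-- Polynomials in n variables: A[x₀,…,xₙ] is A[x₁,…,xₙ][x₀].

module MultivariatePolynomial (A : RawRing c ℓ) where

  polyRing : ℕ → RawRing c ℓ
  polyRing zero    = A
  polyRing (suc n) = Polynomial.ring (polyRing n)

  MPoly : ℕ → Set c
  MPoly n = RawRing.Carrier (polyRing n)

  NonZero : ∀ n → MPoly n → Set ℓ
  NonZero n p = ¬ (p ≈ 0#)
    where open RawRing (polyRing n)

  coefficient : ∀ {n} → MPoly n → Vec ℕ n → RawRing.Carrier A
  coefficient         p []       = p
  coefficient {suc n} p (i ∷ is) = coefficient (Polynomial.coeff (polyRing n) p i) is

  ∂ : ∀ {n} → Fin n → MPoly n → MPoly n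
  ∂ {suc n} zero    p = Polynomial.derivative (polyRing n) p
  ∂ {suc n} (suc i) p = map (∂ i) p

  module _ (S : RawRing c ℓ) (ι : RawRing.Carrier A → RawRing.Carrier S) where

    evaluateAt : ∀ {n} → MPoly n → Vec (RawRing.Carrier S) n → RawRing.Carrier S
    evaluateAt p []       = ι p
    evaluateAt p (x ∷ xs) = evaluate S (λ q → evaluateAt q xs) p x

module Catalytic (A : RawRing c ℓ) where
  open MultivariatePolynomial A public

  module A[u]      = Polynomial A
  module A[[z]]    = PowerSeries A
  module A[u][[z]] = PowerSeries A[u].ring

  -- The variables of Q, in the order α₀, α₁, z, u.
  α₀ α₁ ζ υ : Fin 4
  α₀ = zero
  α₁ = suc zero
  ζ  = suc (suc zero)
  υ  = suc (suc (suc zero))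

  Nonlinear : MPoly 4 → Set ℓ
  Nonlinear Q =
    NonZero 4 (∂ α₀ (∂ α₀ Q)) ⊎ NonZero 4 (∂ α₁ (∂ α₀ Q)) ⊎ NonZero 4 (∂ α₁ (∂ α₁ Q))

  -- M(z,0)
  atu=0 : A[u][[z]].Series → A[[z]].Series
  atu=0 M n = evaluate A (λ a → a) (M n) (RawRing.0# A)

  -- (M(z,u) − M(z,0)) / u
  divided : A[u][[z]].Series → A[u][[z]].Series
  divided M n = A[u].divideByVar (M n + - A[u].const (atu=0 M n))
    where open RawRing A[u].ring

  FunctionalEquation : MPoly 1 → MPoly 4 → A[u][[z]].Series → Set ℓ
  FunctionalEquation F₀ Q M =
    M ≈ ⟦ F₀ ⟧ (u ∷ []) + z * ⟦ Q ⟧ (M ∷ divided M ∷ z ∷ u ∷ [])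
    where
    open RawRing A[u][[z]].ring
    z = A[u][[z]].var
    u = A[u][[z]].const A[u].var
    ⟦_⟧ : ∀ {n} → MPoly n → Vec Carrier n → Carrier
    ⟦_⟧ = evaluateAt A[u][[z]].ring (λ a → A[u][[z]].const (A[u].const a))

  record System (F₀ : MPoly 1) (Q : MPoly 4) (f u w : A[[z]].Series) : Set ℓ where
    open RawRing A[[z]].ring
    private
      module A = RawRing A
      z = A[[z]].var
      ⟦_⟧ : ∀ {n} → MPoly n → Vec Carrier n → Carrier
      ⟦_⟧ = evaluateAt A[[z]].ring A[[z]].const
      ⟦_⟧₀ : MPoly 1 → A.Carrier
      ⟦ p ⟧₀ = evaluateAt A (λ a → a) p (A.0# ∷ [])
      point : Vec Carrier 4
      point = f ∷ w ∷ z ∷ u ∷ []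
    field
      f-equation : f ≈ ⟦ F₀ ⟧ (u ∷ []) + z * ⟦ Q ⟧ point
      u-equation : u ≈ z * u * ⟦ ∂ α₀ Q ⟧ point + z * ⟦ ∂ α₁ Q ⟧ point
      w-equation : w ≈ ⟦ ∂ {1} zero F₀ ⟧ (u ∷ []) + z * ⟦ ∂ υ Q ⟧ point
                       + z * w * ⟦ ∂ α₀ Q ⟧ point
      f-initial  : f 0 A.≈ ⟦ F₀ ⟧₀
      u-initial  : u 0 A.≈ A.0#
      w-initial  : w 0 A.≈ ⟦ ∂ {1} zero F₀ ⟧₀

NonNegative : (K : OrderedCommutativeRing c ℓ₁ ℓ₂) → let open OrderedCommutativeRing K in
              ∀ n → MultivariatePolynomial.MPoly rawRing n → Set ℓ₂
NonNegative K n p = (is : Vec ℕ n) → 0# ≤ coefficient p is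
  where
  open OrderedCommutativeRing K
  open MultivariatePolynomial rawRing

{-# OPTIONS --safe #-}
-- Write N = (M − M(z,0))/u, so that M = M(z,0) + u N, and substitute u = u(z): let
-- f̃ = M(z,u(z)), w̃ = N(z,u(z)), so that f̃ = M(z,0) + u w̃.  Substituting into the
-- functional equation, and into its derivative with respect to u, gives
--   f̃ = F₀(u) + z Q,
--   w̃ = F₀′(u) + z Q_u + z w̃ Q_α₀ − X (u − z u Q_α₀ − z Q_α₁),   X = N_u(z,u(z)),
-- with Q and its derivatives taken at (f̃, w̃, z, u).  If f̃ ≡ f and w̃ ≡ w modulo zⁿ,
-- then the equation for u makes the factor of X vanish modulo zⁿ⁺¹, and hence f̃ ≡ f
-- and w̃ ≡ w modulo zⁿ⁺¹.  So f̃ = f and w̃ = w.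

module Submission where

open import Defs
open import Algebra.Bundles using (CommutativeRing; RawRing)
import Algebra.Definitions.RawMonoid as RawMonoidOps
open import Algebra.Morphism.Structures using (IsRingHomomorphism)
open import Algebra.Structures using (IsCommutativeRing)
import Algebra.Properties.Group as GroupProperties
import Algebra.Properties.Ring as RingProperties
import Algebra.Solver.Ring.NaturalCoefficients.Default as SemiringSolver
open import Data.Fin.Base using (Fin; zero; suc)
open import Data.List.Base using (List; []; _∷_; drop; map)
open import Data.Nat.Base using (ℕ; zero; suc; _≤_; _<_; z≤n; s≤s)
open import Data.Nat.Properties using (≤-refl; ≤-<-trans; m≤n⇒m≤1+n)
open import Data.Product.Base using (_×_; _,_; proj₁; proj₂)
open import Data.Vec.Base as Vec using (Vec; []; _∷_; lookup)
open import Data.Vec.Relation.Binary.Pointwise.Inductive using (Pointwise; []; _∷_)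
open import Level using (_⊔_) renaming (suc to lsuc)
open import Relation.Binary.PropositionalEquality as ≡ using (_≡_)
import Relation.Binary.Reasoning.Setoid as SetoidReasoning

-- Congruences modulo powers of z.

tail : ∀ {a} {X : Set a} → (ℕ → X) → ℕ → X
tail x k = x (suc k)

-- A ring with a z-adic filtration, x ≈[ n ] y standing for congruence modulo zⁿ;
-- Σz x is Σₖ x k zᵏ.
record AdicRing c ℓ : Set (lsuc (c ⊔ ℓ)) where
  infix 4 _≈[_]_
  field
    rawRing : RawRing c ℓ
  open RawRing rawRing public using (Carrier; _+_; _*_; -_; 0#; 1#)
  field
    _≈[_]_            : Carrier → ℕ → Carrier → Set ℓ
    isCommutativeRing : ∀ n → IsCommutativeRing (λ x y → x ≈[ n ] y) _+_ _*_ -_ 0# 1#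
    z                 : Carrier
    Σz                : (ℕ → Carrier) → Carrier
    ≈[0]              : ∀ x y → x ≈[ 0 ] y
    z*-raise          : ∀ {n x y} → x ≈[ n ] y → z * x ≈[ suc n ] z * y
    Σz-unfold         : ∀ n x → Σz x ≈[ n ] x 0 + z * Σz (tail x)

  -- Only the equality varies with n, while carrier and operations stay fixed. The same expression
  -- can thus be compared at several precisions, and each calculation modulo zⁿ takes place in an
  -- ordinary commutative ring.
  modulo : ℕ → CommutativeRing c ℓ
  modulo n = record { isCommutativeRing = isCommutativeRing n }

  module Modulo (n : ℕ) where
    open CommutativeRing (modulo n) public
      hiding (Carrier; _≈_; _+_; _*_; -_; 0#; 1#; rawRing; isCommutativeRing; _-_; zero)
    open SetoidReasoning setoid public
    open SemiringSolver commutativeSemiring public using (solve; _:=_; _:+_; _:*_)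

-- Formal derivatives of coefficient lists.

module Derivative {c ℓ} (A : RawRing c ℓ) where
  open RawRing A
  open RawMonoidOps +-rawMonoid using () renaming (_×_ to _·_)
  open Polynomial A

  -- As a polynomial this is k p + x p′: for k = 1 the derivative of a + x p, for k = 0 the product
  -- x p′.
  weightedFrom : ℕ → Poly → Poly
  weightedFrom k []      = []
  weightedFrom k (a ∷ p) = k · a ∷ weightedFrom (suc k) p

  -- The local function of `derivative` cannot be named; it is the left-hand side
  -- of go≡weightedFrom, inferred from the use in its instance at k = 2.
  mutual
    derivative≡weightedFrom : ∀ a p → derivative (a ∷ p) ≡ weightedFrom 1 p
    derivative≡weightedFrom a []      = ≡.refl
    derivative≡weightedFrom a (b ∷ p) = ≡.cong (1 · b ∷_) (go₂≡weightedFrom a b p)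

    go₂≡weightedFrom : ∀ a b p → drop 1 (derivative (a ∷ b ∷ p)) ≡ weightedFrom 2 p
    -- Abstracting the tail and the number 2 turns the goal into the hidden function applied to
    -- distinct variables, so that unification can solve the underscore in the signature of
    -- `go≡weightedFrom`.
    go₂≡weightedFrom a b p with b ∷ p | 2
    ... | q | k = go≡weightedFrom a q k p

    go≡weightedFrom : ∀ a q k p → _ ≡ weightedFrom k p
    go≡weightedFrom a q k []      = ≡.refl
    go≡weightedFrom a q k (b ∷ p) = ≡.cong (k · b ∷_) (go≡weightedFrom a q (suc k) p)

-- Evaluation of multivariate polynomials.

module Evaluation {c ℓ} (A : CommutativeRing c ℓ) (B : AdicRing c ℓ)
  (ι : CommutativeRing.Carrier A → AdicRing.Carrier B)
  (ι-isHom : ∀ n → IsRingHomomorphism (CommutativeRing.rawRing A)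
                     (CommutativeRing.rawRing (AdicRing.modulo B n)) ι)
  where
  private
    module A = CommutativeRing A
  open AdicRing B
  open MultivariatePolynomial A.rawRing
  module ι n = IsRingHomomorphism (ι-isHom n)
  open RawMonoidOps (RawRing.+-rawMonoid rawRing) using (sum)

  ⟦_⟧ : ∀ {k} → MPoly k → Vec Carrier k → Carrier
  ⟦_⟧ = evaluateAt rawRing ι

  ⟦⟧-0 : ∀ n k (xs : Vec Carrier k) → ⟦ RawRing.0# (polyRing k) ⟧ xs ≈[ n ] 0#
  ⟦⟧-0 n zero    []       = ι.0#-homo n
  ⟦⟧-0 n (suc k) (x ∷ xs) = Modulo.refl n

  ⟦⟧-+ : ∀ n {k} (p q : MPoly k) (xs : Vec Carrier k) →
         ⟦ RawRing._+_ (polyRing k) p q ⟧ xs ≈[ n ] ⟦ p ⟧ xs + ⟦ q ⟧ xs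
  ⟦⟧-+ n p q [] = ι.+-homo n p q
  ⟦⟧-+ n [] q (x ∷ xs) = sym (+-identityˡ _)
    where open Modulo n
  ⟦⟧-+ n (a ∷ p) [] (x ∷ xs) = sym (+-identityʳ _)
    where open Modulo n
  ⟦⟧-+ n {suc k} (a ∷ p) (b ∷ q) (x ∷ xs) = begin
    ⟦ RawRing._+_ (polyRing k) a b ⟧ xs + x * ⟦ RawRing._+_ (polyRing (suc k)) p q ⟧ (x ∷ xs)
      ≈⟨ +-cong (⟦⟧-+ n a b xs) (*-congˡ (⟦⟧-+ n p q (x ∷ xs))) ⟩
    (⟦ a ⟧ xs + ⟦ b ⟧ xs) + x * (⟦ p ⟧ (x ∷ xs) + ⟦ q ⟧ (x ∷ xs))
      ≈⟨ solve 5 (λ a b x p q → (a :+ b) :+ x :* (p :+ q) := (a :+ x :* p) :+ (b :+ x :* q)) refl _ _ _ _ _ ⟩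
    (⟦ a ⟧ xs + x * ⟦ p ⟧ (x ∷ xs)) + (⟦ b ⟧ xs + x * ⟦ q ⟧ (x ∷ xs)) ∎
    where open Modulo n

  ⟦⟧-cong : ∀ n {k} (p : MPoly k) {xs ys : Vec Carrier k} → Pointwise (λ x y → x ≈[ n ] y) xs ys →
            ⟦ p ⟧ xs ≈[ n ] ⟦ p ⟧ ys
  ⟦⟧-cong n p       []             = Modulo.refl n
  ⟦⟧-cong n []      (x≈y ∷ xs≈ys) = Modulo.refl n
  ⟦⟧-cong n (a ∷ p) (x≈y ∷ xs≈ys) =
    +-cong (⟦⟧-cong n a xs≈ys) (*-cong x≈y (⟦⟧-cong n p (x≈y ∷ xs≈ys)))
    where open Modulo n

  module _ {k : ℕ} where
    open Derivative (polyRing k)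
    open Polynomial (polyRing k) using (derivative)
    open RawMonoidOps (RawRing.+-rawMonoid (polyRing k)) using () renaming (_×_ to _·_)

    -- Raising every weight by one contributes one further copy of p.
    ⟦⟧-weightedFrom : ∀ n j (p : MPoly (suc k)) x (xs : Vec Carrier k) →
      ⟦ weightedFrom (suc j) p ⟧ (x ∷ xs) ≈[ n ] ⟦ p ⟧ (x ∷ xs) + ⟦ weightedFrom j p ⟧ (x ∷ xs)
    ⟦⟧-weightedFrom n j []      x xs = sym (+-identityˡ _)
      where open Modulo n
    ⟦⟧-weightedFrom n j (a ∷ p) x xs = begin
      ⟦ suc j · a ⟧ xs + x * ⟦ weightedFrom (suc (suc j)) p ⟧ (x ∷ xs)
        ≈⟨ +-cong (⟦⟧-+ n a (j · a) xs) (*-congˡ (⟦⟧-weightedFrom n (suc j) p x xs)) ⟩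
      (⟦ a ⟧ xs + ⟦ j · a ⟧ xs) + x * (⟦ p ⟧ (x ∷ xs) + ⟦ weightedFrom (suc j) p ⟧ (x ∷ xs))
        ≈⟨ solve 5 (λ a b x p q → (a :+ b) :+ x :* (p :+ q) := (a :+ x :* p) :+ (b :+ x :* q)) refl _ _ _ _ _ ⟩
      (⟦ a ⟧ xs + x * ⟦ p ⟧ (x ∷ xs)) + (⟦ j · a ⟧ xs + x * ⟦ weightedFrom (suc j) p ⟧ (x ∷ xs)) ∎
      where open Modulo n

    -- The head has weight 0 and drops out; the weights 1, 2, ... on the remaining coefficients are
    -- those of the derivative.
    ⟦⟧-weightedFrom₀ : ∀ n (p : MPoly (suc k)) x (xs : Vec Carrier k) →
      ⟦ weightedFrom 0 p ⟧ (x ∷ xs) ≈[ n ] x * ⟦ derivative p ⟧ (x ∷ xs)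
    ⟦⟧-weightedFrom₀ n []      x xs = sym (zeroʳ x)
      where open Modulo n
    ⟦⟧-weightedFrom₀ n (a ∷ p) x xs rewrite derivative≡weightedFrom a p =
      trans (+-congʳ (⟦⟧-0 n k xs)) (+-identityˡ _)
      where open Modulo n

    -- The product rule (x p)′ = p + x p′, obtained by comparing the weights that start at 1 with
    -- those that start at 0.
    ⟦⟧-derivative-∷ : ∀ n a (p : MPoly (suc k)) x (xs : Vec Carrier k) →
      ⟦ derivative (a ∷ p) ⟧ (x ∷ xs) ≈[ n ] ⟦ p ⟧ (x ∷ xs) + x * ⟦ derivative p ⟧ (x ∷ xs)
    ⟦⟧-derivative-∷ n a p x xs rewrite derivative≡weightedFrom a p =
      trans (⟦⟧-weightedFrom n 0 p x xs) (+-congˡ (⟦⟧-weightedFrom₀ n p x xs))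
      where open Modulo n

  -- The chain rule.

  sum-linear : ∀ n {k} x (a b d : Fin k → Carrier) →
    sum (λ i → (a i + x * b i) * d i) ≈[ n ] sum (λ i → a i * d i) + x * sum (λ i → b i * d i)
  sum-linear n {zero}  x a b d = sym (trans (+-identityˡ _) (zeroʳ x))
    where open Modulo n
  sum-linear n {suc k} x a b d = begin
    (a zero + x * b zero) * d zero + sum (λ i → (a (suc i) + x * b (suc i)) * d (suc i))
      ≈⟨ +-congˡ (sum-linear n x (λ i → a (suc i)) (λ i → b (suc i)) (λ i → d (suc i))) ⟩
    (a zero + x * b zero) * d zero + (sum (λ i → a (suc i) * d (suc i)) + x * sum (λ i → b (suc i) * d (suc i)))
      ≈⟨ solve 6 (λ a x b d s t → (a :+ x :* b) :* d :+ (s :+ x :* t) := (a :* d :+ s) :+ x :* (b :* d :+ t)) refl _ _ _ _ _ _ ⟩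
    (a zero * d zero + sum (λ i → a (suc i) * d (suc i))) + x * (b zero * d zero + sum (λ i → b (suc i) * d (suc i))) ∎
    where open Modulo n

  -- Modulo zⁿ, `S` respects sums and products, and `D` is a derivation along `S` that vanishes on
  -- constants. Everything is compared after applying `S` or `D`, so no ring laws have to be
  -- established for series over A[u].
  module Chain (R : RawRing c ℓ) (κ : A.Carrier → RawRing.Carrier R)
    (S D : RawRing.Carrier R → Carrier) (n : ℕ)
    (S-κ : ∀ a → S (κ a) ≈[ n ] ι a)
    (S-0 : S (RawRing.0# R) ≈[ n ] 0#)
    (S-+ : ∀ x y → S (RawRing._+_ R x y) ≈[ n ] S x + S y)
    (S-* : ∀ x y → S (RawRing._*_ R x y) ≈[ n ] S x * S y)
    (D-κ : ∀ a → D (κ a) ≈[ n ] 0#)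
    (D-0 : D (RawRing.0# R) ≈[ n ] 0#)
    (D-+ : ∀ x y → D (RawRing._+_ R x y) ≈[ n ] D x + D y)
    (D-* : ∀ x y → D (RawRing._*_ R x y) ≈[ n ] S x * D y + D x * S y)
    where
    open Modulo n

    private
      evalR : ∀ {k} → MPoly k → Vec (RawRing.Carrier R) k → RawRing.Carrier R
      evalR = evaluateAt R κ

    S-evaluateAt : ∀ {k} (p : MPoly k) (xs : Vec (RawRing.Carrier R) k) → S (evalR p xs) ≈[ n ] ⟦ p ⟧ (Vec.map S xs)
    S-evaluateAt p       []       = S-κ p
    S-evaluateAt []      (x ∷ xs) = S-0
    S-evaluateAt (a ∷ p) (x ∷ xs) = trans (S-+ _ _)
      (+-cong (S-evaluateAt a xs) (trans (S-* _ _) (*-congˡ (S-evaluateAt p (x ∷ xs)))))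

    gradient : ∀ {k} → MPoly k → Vec (RawRing.Carrier R) k → Carrier
    gradient p xs = sum (λ i → ⟦ ∂ i p ⟧ (Vec.map S xs) * D (lookup xs i))

    gradient-0 : ∀ {k} (xs : Vec (RawRing.Carrier R) (suc k)) → gradient {suc k} [] xs ≈[ n ] 0#
    gradient-0 (x ∷ xs) = trans (+-cong (zeroˡ _) (sum-0 (λ i → D (lookup xs i)))) (+-identityˡ _)
      where
      sum-0 : ∀ {k} (d : Fin k → Carrier) → sum (λ i → 0# * d i) ≈[ n ] 0#
      sum-0 {zero}  d = refl
      sum-0 {suc k} d = trans (+-cong (zeroˡ _) (sum-0 (λ i → d (suc i)))) (+-identityˡ _)

    -- Induction on the Horner form a + x p: the product rule splits `D` of x p into S x times the
    -- gradient of p and D x times the value of p.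
    chainRule : ∀ {k} (p : MPoly k) (xs : Vec (RawRing.Carrier R) k) → D (evalR p xs) ≈[ n ] gradient p xs
    chainRule p  []       = D-κ p
    chainRule [] (x ∷ xs) = trans D-0 (sym (gradient-0 (x ∷ xs)))
    chainRule {suc k} (a ∷ p) (x ∷ xs) = begin
      D (evalR (a ∷ p) (x ∷ xs))
        ≈⟨ D-+ _ _ ⟩
      D (evalR a xs) + D (RawRing._*_ R x (evalR p (x ∷ xs)))
        ≈⟨ +-cong (chainRule a xs) (trans (D-* _ _)
             (+-cong (*-congˡ (chainRule p (x ∷ xs))) (*-congˡ (S-evaluateAt p (x ∷ xs))))) ⟩
      gradient a xs + (S x * (p₀ * D x + rest) + D x * ⟦ p ⟧ X)
        ≈⟨ solve 6 (λ g s p₀ d r e → g :+ (s :* (p₀ :* d :+ r) :+ d :* e)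
                                  := (e :+ s :* p₀) :* d :+ (g :+ s :* r)) refl _ _ _ _ _ _ ⟩
      (⟦ p ⟧ X + S x * p₀) * D x + (gradient a xs + S x * rest)
        -- The collected factor of `D x` is the derivative of a + x p in its first variable. In the
        -- other variables differentiation acts on coefficients, so x merely passes through the sum.
        ≈⟨ +-cong (*-congʳ (⟦⟧-derivative-∷ n a p (S x) (Vec.map S xs)))
             (sum-linear n (S x) (λ i → ⟦ ∂ i a ⟧ (Vec.map S xs)) (λ i → ⟦ map (∂ i) p ⟧ X) (λ i → D (lookup xs i))) ⟨
      gradient {suc k} (a ∷ p) (x ∷ xs) ∎
      where
      X : Vec Carrier (suc k)
      X = S x ∷ Vec.map S xs
      p₀ rest : Carrier
      p₀ = ⟦ ∂ {suc k} zero p ⟧ X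
      rest = sum (λ i → ⟦ map (∂ i) p ⟧ X * D (lookup xs i))

-- Values of polynomials in u, and of their derivatives, at U.

module Substitution {c ℓ} (A : CommutativeRing c ℓ) (B : AdicRing c ℓ)
  (ι : CommutativeRing.Carrier A → AdicRing.Carrier B)
  (ι-isHom : ∀ n → IsRingHomomorphism (CommutativeRing.rawRing A)
                     (CommutativeRing.rawRing (AdicRing.modulo B n)) ι)
  (U : AdicRing.Carrier B)
  where
  private
    module A = CommutativeRing A
  open AdicRing B
  open Catalytic A.rawRing
  open A[u] using (Poly; coeff; add; mul)
  open Evaluation A B ι ι-isHom

  at : Poly → Carrier
  at p = ⟦ p ⟧ (U ∷ [])

  -- The value at U of the derivative of a polynomial.
  at′ : Poly → Carrier
  at′ []      = 0#
  at′ (a ∷ p) = at p + U * at′ p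

  at-+ : ∀ n p q → at (add p q) ≈[ n ] at p + at q
  at-+ n p q = ⟦⟧-+ n p q (U ∷ [])

  at′-+ : ∀ n p q → at′ (add p q) ≈[ n ] at′ p + at′ q
  at′-+ n []      q       = sym (+-identityˡ _)
    where open Modulo n
  at′-+ n (a ∷ p) []      = sym (+-identityʳ _)
    where open Modulo n
  at′-+ n (a ∷ p) (b ∷ q) = trans (+-cong (at-+ n p q) (*-congˡ (at′-+ n p q)))
    (solve 5 (λ p q u p′ q′ → (p :+ q) :+ u :* (p′ :+ q′) := (p :+ u :* p′) :+ (q :+ u :* q′)) refl _ _ _ _ _)
    where open Modulo n

  at-scale : ∀ n a p → at (map (a A.*_) p) ≈[ n ] ι a * at p
  at-scale n a []      = sym (zeroʳ _)
    where open Modulo n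
  at-scale n a (b ∷ p) = trans (+-cong (ι.*-homo n a b) (*-congˡ (at-scale n a p)))
    (solve 4 (λ a b u p → a :* b :+ u :* (a :* p) := a :* (b :+ u :* p)) refl _ _ _ _)
    where open Modulo n

  at′-scale : ∀ n a p → at′ (map (a A.*_) p) ≈[ n ] ι a * at′ p
  at′-scale n a []      = sym (zeroʳ _)
    where open Modulo n
  at′-scale n a (b ∷ p) = trans (+-cong (at-scale n a p) (*-congˡ (at′-scale n a p)))
    (solve 4 (λ a u p p′ → a :* p :+ u :* (a :* p′) := a :* (p :+ u :* p′)) refl _ _ _ _)
    where open Modulo n

  at-* : ∀ n p q → at (mul p q) ≈[ n ] at p * at q
  at-* n []      q = sym (zeroˡ _)
    where open Modulo n
  at-* n (a ∷ p) q = begin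
    at (add (map (a A.*_) q) (A.0# ∷ mul p q))
      ≈⟨ at-+ n (map (a A.*_) q) _ ⟩
    at (map (a A.*_) q) + (ι A.0# + U * at (mul p q))
      ≈⟨ +-cong (at-scale n a q) (+-cong (ι.0#-homo n) (*-congˡ (at-* n p q))) ⟩
    ι a * at q + (0# + U * (at p * at q))
      ≈⟨ +-congˡ (+-identityˡ _) ⟩
    ι a * at q + U * (at p * at q)
      ≈⟨ solve 4 (λ a q u p → a :* q :+ u :* (p :* q) := (a :+ u :* p) :* q) refl _ _ _ _ ⟩
    (ι a + U * at p) * at q ∎
    where open Modulo n

  at′-* : ∀ n p q → at′ (mul p q) ≈[ n ] at p * at′ q + at′ p * at q
  at′-* n []      q = sym (trans (+-cong (zeroˡ _) (zeroˡ _)) (+-identityˡ _))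
    where open Modulo n
  at′-* n (a ∷ p) q = begin
    at′ (add (map (a A.*_) q) (A.0# ∷ mul p q))
      ≈⟨ at′-+ n (map (a A.*_) q) _ ⟩
    at′ (map (a A.*_) q) + (at (mul p q) + U * at′ (mul p q))
      ≈⟨ +-cong (at′-scale n a q) (+-cong (at-* n p q) (*-congˡ (at′-* n p q))) ⟩
    ι a * at′ q + (at p * at q + U * (at p * at′ q + at′ p * at q))
      ≈⟨ solve 6 (λ a q q′ u p p′ → a :* q′ :+ (p :* q :+ u :* (p :* q′ :+ p′ :* q))
                                 := (a :+ u :* p) :* q′ :+ (p :+ u :* p′) :* q) refl _ _ _ _ _ _ ⟩
    (ι a + U * at p) * at′ q + (at p + U * at′ p) * at q ∎
    where open Modulo n

  -- Equality of polynomials is coefficientwise, so equal lists may differ in length; this disposes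
  -- of the surplus entries in `at-cong`.
  at-zero : ∀ n p → (∀ i → coeff p i A.≈ A.0#) → at p ≈[ n ] 0#
  at-zero n []      _   = Modulo.refl n
  at-zero n (a ∷ p) p≈0 = begin
    ι a + U * at p ≈⟨ +-cong (trans (ι.⟦⟧-cong n (p≈0 0)) (ι.0#-homo n)) (*-congˡ (at-zero n p (λ i → p≈0 (suc i)))) ⟩
    0# + U * 0#    ≈⟨ trans (+-identityˡ _) (zeroʳ _) ⟩
    0#             ∎
    where open Modulo n

  at′-zero : ∀ n p → (∀ i → coeff p i A.≈ A.0#) → at′ p ≈[ n ] 0#
  at′-zero n []      _   = Modulo.refl n
  at′-zero n (a ∷ p) p≈0 = begin
    at p + U * at′ p ≈⟨ +-cong (at-zero n p (λ i → p≈0 (suc i))) (*-congˡ (at′-zero n p (λ i → p≈0 (suc i)))) ⟩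
    0# + U * 0#      ≈⟨ trans (+-identityˡ _) (zeroʳ _) ⟩
    0#               ∎
    where open Modulo n

  at-cong : ∀ n p q → (∀ i → coeff p i A.≈ coeff q i) → at p ≈[ n ] at q
  at-cong n []      q       p≈q = Modulo.sym n (at-zero n q (λ i → A.sym (p≈q i)))
  at-cong n (a ∷ p) []      p≈q = at-zero n (a ∷ p) p≈q
  at-cong n (a ∷ p) (b ∷ q) p≈q =
    +-cong (ι.⟦⟧-cong n (p≈q 0)) (*-congˡ (at-cong n p q (λ i → p≈q (suc i))))
    where open Modulo n

  at′-cong : ∀ n p q → (∀ i → coeff p i A.≈ coeff q i) → at′ p ≈[ n ] at′ q
  at′-cong n []      q       p≈q = Modulo.sym n (at′-zero n q (λ i → A.sym (p≈q i)))
  at′-cong n (a ∷ p) []      p≈q = at′-zero n (a ∷ p) p≈q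
  at′-cong n (a ∷ p) (b ∷ q) p≈q =
    +-cong (at-cong n p q (λ i → p≈q (suc i))) (*-congˡ (at′-cong n p q (λ i → p≈q (suc i))))
    where open Modulo n

  at-quotient : ∀ n p → at p ≈[ n ] ι (evaluate A.rawRing (λ a → a) p A.0#) + U * at (drop 1 p)
  at-quotient n []      = sym (trans (+-cong (ι.0#-homo n) (zeroʳ _)) (+-identityˡ _))
    where open Modulo n
  at-quotient n (a ∷ p) =
    +-congʳ (ι.⟦⟧-cong n (A.sym (A.trans (A.+-congˡ (A.zeroˡ _)) (A.+-identityʳ a))))
    where open Modulo n

  -- The product rule for p = p(0) + u q with q = `drop 1 p`. Since `at′` recurses in the same way,
  -- the nonempty case holds by definition.
  at′-quotient : ∀ n p → at′ p ≈[ n ] at (drop 1 p) + U * at′ (drop 1 p)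
  at′-quotient n []      = sym (trans (+-identityˡ _) (zeroʳ _))
    where open Modulo n
  at′-quotient n (a ∷ p) = Modulo.refl n

  -- Subtracting M(z,0) alters only the constant coefficient, which the division then discards. The
  -- equality is propositional, so `divided` can be rewritten to a plain shift.
  divideByVar-constant : ∀ p b → A[u].divideByVar (add p (b ∷ [])) ≡ drop 1 p
  divideByVar-constant []          b = ≡.refl
  divideByVar-constant (a ∷ [])    b = ≡.refl
  divideByVar-constant (a ∷ _ ∷ _) b = ≡.refl

  -- Sums of the form Σₖ xₖ zᵏ.

  Σz-cong : ∀ n {x y : ℕ → Carrier} → (∀ m k → x k ≈[ m ] y k) → Σz x ≈[ n ] Σz y
  Σz-cong zero    x≈y = ≈[0] _ _
  Σz-cong (suc n) {x} {y} x≈y = begin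
    Σz x                  ≈⟨ Σz-unfold _ x ⟩
    -- Unfolding once puts the tail behind a factor z, so the tail is needed only modulo zⁿ. The
    -- heads are compared at a different precision in each round, hence the hypothesis at every m.
    x 0 + z * Σz (tail x) ≈⟨ +-cong (x≈y (suc n) 0) (z*-raise (Σz-cong n (λ m k → x≈y m (suc k)))) ⟩
    y 0 + z * Σz (tail y) ≈⟨ Σz-unfold _ y ⟨
    Σz y                  ∎
    where open Modulo (suc n)

  Σz-0 : ∀ n → Σz (λ _ → 0#) ≈[ n ] 0#
  Σz-0 zero    = ≈[0] _ _
  Σz-0 (suc n) = begin
    Σz (λ _ → 0#)          ≈⟨ Σz-unfold _ _ ⟩
    0# + z * Σz (λ _ → 0#) ≈⟨ +-congˡ (z*-raise (Σz-0 n)) ⟩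
    0# + z * 0#            ≈⟨ trans (+-identityˡ _) (zeroʳ _) ⟩
    0#                     ∎
    where open Modulo (suc n)

  Σz-+ : ∀ n (x y : ℕ → Carrier) → Σz (λ k → x k + y k) ≈[ n ] Σz x + Σz y
  Σz-+ zero    x y = ≈[0] _ _
  Σz-+ (suc n) x y = begin
    Σz (λ k → x k + y k)
      ≈⟨ Σz-unfold _ _ ⟩
    (x 0 + y 0) + z * Σz (λ k → x (suc k) + y (suc k))
      ≈⟨ +-congˡ (z*-raise (Σz-+ n (tail x) (tail y))) ⟩
    (x 0 + y 0) + z * (Σz (tail x) + Σz (tail y))
      ≈⟨ solve 5 (λ x y z s t → (x :+ y) :+ z :* (s :+ t) := (x :+ z :* s) :+ (y :+ z :* t)) refl _ _ _ _ _ ⟩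
    (x 0 + z * Σz (tail x)) + (y 0 + z * Σz (tail y))
      ≈⟨ +-cong (Σz-unfold _ x) (Σz-unfold _ y) ⟨
    Σz x + Σz y ∎
    where open Modulo (suc n)

  Σz-scale : ∀ n a (x : ℕ → Carrier) → Σz (λ k → a * x k) ≈[ n ] a * Σz x
  Σz-scale zero    a x = ≈[0] _ _
  Σz-scale (suc n) a x = begin
    Σz (λ k → a * x k)
      ≈⟨ Σz-unfold _ _ ⟩
    a * x 0 + z * Σz (λ k → a * x (suc k))
      ≈⟨ +-congˡ (z*-raise (Σz-scale n a (tail x))) ⟩
    a * x 0 + z * (a * Σz (tail x))
      ≈⟨ solve 4 (λ a x z s → a :* x :+ z :* (a :* s) := a :* (x :+ z :* s)) refl _ _ _ _ ⟩
    a * (x 0 + z * Σz (tail x))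
      ≈⟨ *-congˡ (Σz-unfold _ x) ⟨
    a * Σz x ∎
    where open Modulo (suc n)

  -- Substitution and differentiation as maps on power series over A[u].

  open A[u][[z]] using (Series)

  private
    module R = RawRing A[u][[z]].ring

  -- S substitutes U for u, and D is differentiation in u followed by S.
  S D : Series → Carrier
  S g = Σz (λ k → at (g k))
  D g = Σz (λ k → at′ (g k))

  S-cong : ∀ n g h → g R.≈ h → S g ≈[ n ] S h
  S-cong n g h g≈h = Σz-cong n (λ m k → at-cong m (g k) (h k) (g≈h k))

  D-cong : ∀ n g h → g R.≈ h → D g ≈[ n ] D h
  D-cong n g h g≈h = Σz-cong n (λ m k → at′-cong m (g k) (h k) (g≈h k))

  S-+ : ∀ n g h → S (g R.+ h) ≈[ n ] S g + S h
  S-+ n g h = Modulo.trans n (Σz-cong n (λ m k → at-+ m (g k) (h k))) (Σz-+ n _ _)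

  D-+ : ∀ n g h → D (g R.+ h) ≈[ n ] D g + D h
  D-+ n g h = Modulo.trans n (Σz-cong n (λ m k → at′-+ m (g k) (h k))) (Σz-+ n _ _)

  Σz-head : ∀ n (x : ℕ → Carrier) → (∀ m k → x (suc k) ≈[ m ] 0#) → Σz x ≈[ n ] x 0
  Σz-head n x tail≈0 = begin
    Σz x                  ≈⟨ Σz-unfold n x ⟩
    x 0 + z * Σz (tail x) ≈⟨ +-congˡ (*-congˡ (trans (Σz-cong n tail≈0) (Σz-0 n))) ⟩
    x 0 + z * 0#          ≈⟨ trans (+-congˡ (zeroʳ z)) (+-identityʳ _) ⟩
    x 0                   ∎
    where open Modulo n

  S-const : ∀ n p → S (A[u][[z]].const p) ≈[ n ] at p
  S-const n p = Σz-head n _ (λ m k → Modulo.refl m)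

  D-const : ∀ n p → D (A[u][[z]].const p) ≈[ n ] at′ p
  D-const n p = Σz-head n _ (λ m k → Modulo.refl m)

  at-constant : ∀ n a → at (A[u].const a) ≈[ n ] ι a
  at-constant n a = trans (+-congˡ (zeroʳ U)) (+-identityʳ _)
    where open Modulo n

  at′-constant : ∀ n a → at′ (A[u].const a) ≈[ n ] 0#
  at′-constant n a = trans (+-identityˡ _) (zeroʳ U)
    where open Modulo n

  S-u : ∀ n → S (A[u][[z]].const A[u].var) ≈[ n ] U
  S-u n = begin
    S (A[u][[z]].const A[u].var)    ≈⟨ S-const n A[u].var ⟩
    ι A.0# + U * at (A[u].const A.1#) ≈⟨ +-cong (ι.0#-homo n) (*-congˡ (trans (at-constant n A.1#) (ι.1#-homo n))) ⟩
    0# + U * 1#                     ≈⟨ trans (+-identityˡ _) (*-identityʳ U) ⟩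
    U                               ∎
    where open Modulo n

  D-u : ∀ n → D (A[u][[z]].const A[u].var) ≈[ n ] 1#
  D-u n = begin
    D (A[u][[z]].const A[u].var)                        ≈⟨ D-const n A[u].var ⟩
    at (A[u].const A.1#) + U * at′ (A[u].const A.1#) ≈⟨ +-cong (trans (at-constant n A.1#) (ι.1#-homo n)) (*-congˡ (at′-constant n A.1#)) ⟩
    1# + U * 0#                                         ≈⟨ trans (+-congˡ (zeroʳ U)) (+-identityʳ _) ⟩
    1#                                                  ∎
    where open Modulo n

  S-z : ∀ n → S A[u][[z]].var ≈[ n ] z
  S-z n = begin
    S A[u][[z]].var
      ≈⟨ Σz-unfold n _ ⟩
    0# + z * S (tail A[u][[z]].var)
      ≈⟨ +-identityˡ _ ⟩
    z * S (tail A[u][[z]].var)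
      ≈⟨ *-congˡ (Σz-head n _ (λ m k → Modulo.refl m)) ⟩
    z * at (A[u].const A.1#)
      ≈⟨ *-congˡ (trans (at-constant n A.1#) (ι.1#-homo n)) ⟩
    z * 1#
      ≈⟨ *-identityʳ z ⟩
    z ∎
    where open Modulo n

  D-z : ∀ n → D A[u][[z]].var ≈[ n ] 0#
  D-z n = trans (Σz-cong n at′-var) (Σz-0 n)
    where
    open Modulo n
    at′-var : ∀ m k → at′ (A[u][[z]].var k) ≈[ m ] 0#
    at′-var m 0             = Modulo.refl m
    at′-var m 1             = at′-constant m A.1#
    at′-var m (suc (suc k)) = Modulo.refl m

  S-scale : ∀ n p g → S (λ k → mul p (g k)) ≈[ n ] at p * S g
  S-scale n p g = Modulo.trans n (Σz-cong n (λ m k → at-* m p (g k))) (Σz-scale n _ _)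

  D-scale : ∀ n p g → D (λ k → mul p (g k)) ≈[ n ] at p * D g + at′ p * S g
  D-scale n p g = begin
    D (λ k → mul p (g k))                          ≈⟨ Σz-cong n (λ m k → at′-* m p (g k)) ⟩
    Σz (λ k → at p * at′ (g k) + at′ p * at (g k)) ≈⟨ Σz-+ n _ _ ⟩
    Σz (λ k → at p * at′ (g k)) + Σz (λ k → at′ p * at (g k))
                                                   ≈⟨ +-cong (Σz-scale n _ _) (Σz-scale n _ _) ⟩
    at p * D g + at′ p * S g                       ∎
    where open Modulo n

  -- With g₁ and h₁ the tails, g h = g₀h₀ + z (g₀h₁ + g₁h), where the shape of the tail holds by
  -- computation of the convolution. Induction on the precision then replaces a rearrangement of
  -- double sums.
  S-* : ∀ n g h → S (g R.* h) ≈[ n ] S g * S h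
  S-* zero    g h = ≈[0] _ _
  S-* (suc n) g h = begin
    S (g R.* h)
      ≈⟨ Σz-unfold _ _ ⟩
    -- The constant term of a product is a one-term `sum`, which ends in the zero polynomial [].
    at (add (mul (g 0) (h 0)) []) + z * S (tail (g R.* h))
      ≈⟨ +-cong (trans (at-+ _ (mul (g 0) (h 0)) []) (trans (+-identityʳ _) (at-* _ (g 0) (h 0)))) (z*-raise S-tail) ⟩
    at (g 0) * at (h 0) + z * (at (g 0) * S (tail h) + S (tail g) * S h)
      ≈⟨ solve 6 (λ g h z s t x → g :* h :+ z :* (g :* t :+ s :* x) := g :* (h :+ z :* t) :+ z :* s :* x) refl _ _ _ _ _ _ ⟩
    at (g 0) * (at (h 0) + z * S (tail h)) + z * S (tail g) * S h
      ≈⟨ +-congʳ (*-congˡ (Σz-unfold _ _)) ⟨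
    at (g 0) * S h + z * S (tail g) * S h
      ≈⟨ distribʳ _ _ _ ⟨
    (at (g 0) + z * S (tail g)) * S h
      ≈⟨ *-congʳ (Σz-unfold _ _) ⟨
    S g * S h ∎
    where
    open Modulo (suc n)
    S-tail : S (tail (g R.* h)) ≈[ n ] at (g 0) * S (tail h) + S (tail g) * S h
    S-tail = Modulo.trans n (S-+ n (λ k → mul (g 0) (h (suc k))) (tail g R.* h))
      (Modulo.+-cong n (S-scale n (g 0) (tail h)) (S-* n (tail g) h))

  -- The splitting used for `S-*`, with the product rule for polynomials applied to g₀h₀ and to g₀
  -- times the tail of h.
  D-* : ∀ n g h → D (g R.* h) ≈[ n ] S g * D h + D g * S h
  D-* zero    g h = ≈[0] _ _
  D-* (suc n) g h = begin
    D (g R.* h)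
      ≈⟨ Σz-unfold _ _ ⟩
    at′ (add (mul (g 0) (h 0)) []) + z * D (tail (g R.* h))
      ≈⟨ +-cong (trans (at′-+ _ (mul (g 0) (h 0)) []) (trans (+-identityʳ _) (at′-* _ (g 0) (h 0)))) (z*-raise D-tail) ⟩
    (at (g 0) * at′ (h 0) + at′ (g 0) * at (h 0))
      + z * ((at (g 0) * D (tail h) + at′ (g 0) * S (tail h)) + (S (tail g) * D h + D (tail g) * S h))
      ≈⟨ solve 11 (λ g g′ h h′ z s s′ t t′ x x′ →
            (g :* h′ :+ g′ :* h) :+ z :* ((g :* t′ :+ g′ :* t) :+ (s :* x′ :+ s′ :* x))
         := (g :* (h′ :+ z :* t′) :+ z :* s :* x′) :+ (g′ :* (h :+ z :* t) :+ z :* s′ :* x))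
            refl _ _ _ _ _ _ _ _ _ _ _ ⟩
    (at (g 0) * (at′ (h 0) + z * D (tail h)) + z * S (tail g) * D h)
      + (at′ (g 0) * (at (h 0) + z * S (tail h)) + z * D (tail g) * S h)
      ≈⟨ +-cong (+-congʳ (*-congˡ (Σz-unfold _ _))) (+-congʳ (*-congˡ (Σz-unfold _ _))) ⟨
    (at (g 0) * D h + z * S (tail g) * D h) + (at′ (g 0) * S h + z * D (tail g) * S h)
      ≈⟨ +-cong (distribʳ _ _ _) (distribʳ _ _ _) ⟨
    (at (g 0) + z * S (tail g)) * D h + (at′ (g 0) + z * D (tail g)) * S h
      ≈⟨ +-cong (*-congʳ (Σz-unfold _ _)) (*-congʳ (Σz-unfold _ _)) ⟨
    S g * D h + D g * S h ∎
    where
    open Modulo (suc n)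
    D-tail : D (tail (g R.* h)) ≈[ n ]
             (at (g 0) * D (tail h) + at′ (g 0) * S (tail h)) + (S (tail g) * D h + D (tail g) * S h)
    D-tail = Modulo.trans n (D-+ n (λ k → mul (g 0) (h (suc k))) (tail g R.* h))
      (Modulo.+-cong n (D-scale n (g 0) (tail h)) (D-* n (tail g) h))

  -- The quotient (M - M(z,0))/u.

  S-divided : ∀ n M → S M ≈[ n ] Σz (λ k → ι (atu=0 M k)) + U * S (divided M)
  S-divided n M = begin
    S M
      ≈⟨ Σz-cong n pointwise ⟩
    Σz (λ k → ι (atu=0 M k) + U * at (divided M k))
      ≈⟨ Σz-+ n _ _ ⟩
    Σz (λ k → ι (atu=0 M k)) + Σz (λ k → U * at (divided M k))
      ≈⟨ +-congˡ (Σz-scale n U _) ⟩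
    Σz (λ k → ι (atu=0 M k)) + U * S (divided M) ∎
    where
    open Modulo n
    pointwise : ∀ m k → at (M k) ≈[ m ] ι (atu=0 M k) + U * at (divided M k)
    pointwise m k rewrite divideByVar-constant (M k) (A.- atu=0 M k) = at-quotient m (M k)

  -- The u-derivative of M(z,0) + u N is N + u N_u, because M(z,0) is free of u.
  D-divided : ∀ n M → D M ≈[ n ] S (divided M) + U * D (divided M)
  D-divided n M = begin
    D M
      ≈⟨ Σz-cong n pointwise ⟩
    Σz (λ k → at (divided M k) + U * at′ (divided M k))
      ≈⟨ Σz-+ n _ _ ⟩
    S (divided M) + Σz (λ k → U * at′ (divided M k))
      ≈⟨ +-congˡ (Σz-scale n U _) ⟩
    S (divided M) + U * D (divided M) ∎
    where
    open Modulo n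
    pointwise : ∀ m k → at′ (M k) ≈[ m ] at (divided M k) + U * at′ (divided M k)
    pointwise m k rewrite divideByVar-constant (M k) (A.- atu=0 M k) = at′-quotient m (M k)

  private
    κ : A.Carrier → Series
    κ a = A[u][[z]].const (A[u].const a)

    S-κ : ∀ n a → S (κ a) ≈[ n ] ι a
    S-κ n a = Modulo.trans n (S-const n _) (at-constant n a)

    D-κ : ∀ n a → D (κ a) ≈[ n ] 0#
    D-κ n a = Modulo.trans n (D-const n _) (at′-constant n a)

    module Calculus n = Chain A[u][[z]].ring κ S D n
      (S-κ n) (S-const n []) (S-+ n) (S-* n) (D-κ n) (D-const n []) (D-+ n) (D-* n)

  -- The kernel method.

  module _ (F₀ : MPoly 1) (Q : MPoly 4) (M : Series) (M-equation : FunctionalEquation F₀ Q M)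
    (f w : Carrier)
    (f-equation : ∀ n → f ≈[ n ] ⟦ F₀ ⟧ (U ∷ []) + z * ⟦ Q ⟧ (f ∷ w ∷ z ∷ U ∷ []))
    (U-equation : ∀ n → U ≈[ n ] z * U * ⟦ ∂ α₀ Q ⟧ (f ∷ w ∷ z ∷ U ∷ [])
                                 + z * ⟦ ∂ α₁ Q ⟧ (f ∷ w ∷ z ∷ U ∷ []))
    (w-equation : ∀ n → w ≈[ n ] ⟦ ∂ {1} zero F₀ ⟧ (U ∷ []) + z * ⟦ ∂ υ Q ⟧ (f ∷ w ∷ z ∷ U ∷ [])
                                 + z * w * ⟦ ∂ α₀ Q ⟧ (f ∷ w ∷ z ∷ U ∷ []))
    where

    private
      N uR zR : Series
      N  = divided M
      uR = A[u][[z]].const A[u].var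
      zR = A[u][[z]].var

      f̃ w̃ : Carrier
      f̃ = S M
      w̃ = S N

      point point~ : Vec Carrier 4
      point  = f ∷ w ∷ z ∷ U ∷ []
      point~ = f̃ ∷ w̃ ∷ z ∷ U ∷ []

      pointR : Vec Series 4
      pointR = M ∷ N ∷ zR ∷ uR ∷ []

      F′ : Carrier
      F′ = ⟦ ∂ {1} zero F₀ ⟧ (U ∷ [])

      QR FR : Series
      QR = evaluateAt A[u][[z]].ring κ Q pointR
      FR = evaluateAt A[u][[z]].ring κ F₀ (uR ∷ [])

      S-pointR : ∀ n → Pointwise (λ x y → x ≈[ n ] y) (Vec.map S pointR) point~
      S-pointR n = Modulo.refl n ∷ Modulo.refl n ∷ S-z n ∷ S-u n ∷ []

    f̃-equation : ∀ n → f̃ ≈[ n ] ⟦ F₀ ⟧ (U ∷ []) + z * ⟦ Q ⟧ point~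
    f̃-equation n = begin
      S M                 ≈⟨ S-cong n M (FR R.+ zR R.* QR) M-equation ⟩
      S (FR R.+ zR R.* QR) ≈⟨ trans (S-+ n FR (zR R.* QR)) (+-congˡ (S-* n zR QR)) ⟩
      S FR + S zR * S QR  ≈⟨ +-cong (trans (Calculus.S-evaluateAt n F₀ (uR ∷ [])) (⟦⟧-cong n F₀ (S-u n ∷ [])))
                               (*-cong (S-z n) (trans (Calculus.S-evaluateAt n Q pointR) (⟦⟧-cong n Q (S-pointR n)))) ⟩
      ⟦ F₀ ⟧ (U ∷ []) + z * ⟦ Q ⟧ point~ ∎
      where open Modulo n

    -- `D` is applied to the functional equation: z passes through because `D` of z is 0, and the
    -- chain rule for Q uses `D M` = w̃ + U `D N` together with `D` of u being 1.
    D-equation : ∀ n → w̃ + U * D N ≈[ n ]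
      F′ + z * (⟦ ∂ α₀ Q ⟧ point~ * (w̃ + U * D N) + (⟦ ∂ α₁ Q ⟧ point~ * D N + ⟦ ∂ υ Q ⟧ point~))
    D-equation n = begin
      w̃ + U * D N
        ≈⟨ D-divided n M ⟨
      D M
        ≈⟨ D-cong n M (FR R.+ zR R.* QR) M-equation ⟩
      D (FR R.+ zR R.* QR)
        ≈⟨ trans (D-+ n FR (zR R.* QR)) (+-congˡ (D-* n zR QR)) ⟩
      D FR + (S zR * D QR + D zR * S QR)
        ≈⟨ +-cong D-FR (trans (+-cong (*-cong (S-z n) D-QR) (trans (*-congʳ (D-z n)) (zeroˡ _))) (+-identityʳ _)) ⟩
      F′ + z * (⟦ ∂ α₀ Q ⟧ point~ * (w̃ + U * D N) + (⟦ ∂ α₁ Q ⟧ point~ * D N + ⟦ ∂ υ Q ⟧ point~)) ∎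
      where
      open Modulo n
      -- In each gradient here u is the last variable: its summand has the factor `D uR`, which is
      -- 1, and is followed by the empty sum.
      *D-u : ∀ {x y} → x ≈[ n ] y → x * D uR + 0# ≈[ n ] y
      *D-u x≈y = trans (+-identityʳ _) (trans (*-cong x≈y (D-u n)) (*-identityʳ _))
      D-FR : D FR ≈[ n ] F′
      D-FR = trans (Calculus.chainRule n F₀ (uR ∷ [])) (*D-u (⟦⟧-cong n (∂ {1} zero F₀) (S-u n ∷ [])))
      D-QR : D QR ≈[ n ]
        ⟦ ∂ α₀ Q ⟧ point~ * (w̃ + U * D N) + (⟦ ∂ α₁ Q ⟧ point~ * D N + ⟦ ∂ υ Q ⟧ point~)
      D-QR = trans (Calculus.chainRule n Q pointR)
        (+-cong (*-cong (⟦⟧-cong n (∂ α₀ Q) (S-pointR n)) (D-divided n M))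
          (+-cong (*-congʳ (⟦⟧-cong n (∂ α₁ Q) (S-pointR n)))
            (trans (+-cong (trans (*-congˡ (D-z n)) (zeroʳ _)) (*D-u (⟦⟧-cong n (∂ υ Q) (S-pointR n))))
              (+-identityˡ _))))

    -- The unknown `D N` has coefficient U on the left and z U Q_α₀ + z Q_α₁ on the right. These
    -- agree modulo zⁿ⁺¹, one power more than the points do, so `D N` cancels and an equation for w̃
    -- alone remains.
    w̃-equation : ∀ n → Pointwise (λ x y → x ≈[ n ] y) point~ point →
      w̃ ≈[ suc n ] F′ + z * ⟦ ∂ υ Q ⟧ point~ + z * (⟦ ∂ α₀ Q ⟧ point~ * w̃)
    w̃-equation n point~≈point = ∙-cancelʳ (U * D N) _ _ (begin
      w̃ + U * D N
        ≈⟨ D-equation (suc n) ⟩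
      F′ + z * (a * (w̃ + U * D N) + (b * D N + q))
        ≈⟨ solve 8 (λ F z a w u x b q → F :+ z :* (a :* (w :+ u :* x) :+ (b :* x :+ q))
             := (F :+ z :* q :+ z :* (a :* w)) :+ (u :* (z :* a) :+ z :* b) :* x) refl _ _ _ _ _ _ _ _ ⟩
      F′ + z * q + z * (a * w̃) + (U * (z * a) + z * b) * D N
        ≈⟨ +-congˡ (*-congʳ kernel) ⟨
      F′ + z * q + z * (a * w̃) + U * D N ∎)
      where
      open Modulo (suc n)
      open GroupProperties +-group using (∙-cancelʳ)
      a b q : Carrier
      a = ⟦ ∂ α₀ Q ⟧ point~
      b = ⟦ ∂ α₁ Q ⟧ point~
      q = ⟦ ∂ υ Q ⟧ point~
      -- The equation for U holds at the solution; moving it to the substituted point is exact only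
      -- modulo zⁿ, and the factor z regains the lost power.
      kernel : U ≈[ suc n ] U * (z * a) + z * b
      kernel = begin
        U
          ≈⟨ U-equation (suc n) ⟩
        z * U * ⟦ ∂ α₀ Q ⟧ point + z * ⟦ ∂ α₁ Q ⟧ point
          ≈⟨ +-congʳ (solve 3 (λ z u a → z :* u :* a := u :* (z :* a)) refl _ _ _) ⟩
        U * (z * ⟦ ∂ α₀ Q ⟧ point) + z * ⟦ ∂ α₁ Q ⟧ point
          ≈⟨ +-cong (*-congˡ (z*-raise (⟦⟧-cong n (∂ α₀ Q) point~≈point)))
                    (z*-raise (⟦⟧-cong n (∂ α₁ Q) point~≈point)) ⟨
        U * (z * a) + z * b ∎

    -- Both pairs share the same U, so the terms F₀(U) and F₀′(U) coincide, and all other terms of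
    -- the equations carry a factor z. Agreement modulo zⁿ therefore improves to zⁿ⁺¹.
    substituted≈solution : ∀ n → (f̃ ≈[ n ] f) × (w̃ ≈[ n ] w)
    substituted≈solution zero    = ≈[0] _ _ , ≈[0] _ _
    substituted≈solution (suc n) with substituted≈solution n
    ... | f̃≈f , w̃≈w =
      (begin
        f̃                                  ≈⟨ f̃-equation (suc n) ⟩
        ⟦ F₀ ⟧ (U ∷ []) + z * ⟦ Q ⟧ point~ ≈⟨ +-congˡ (z*-raise (⟦⟧-cong n Q points)) ⟩
        ⟦ F₀ ⟧ (U ∷ []) + z * ⟦ Q ⟧ point  ≈⟨ f-equation (suc n) ⟨
        f                                  ∎) ,
      (begin
        w̃
          ≈⟨ w̃-equation n points ⟩
        F′ + z * ⟦ ∂ υ Q ⟧ point~ + z * (⟦ ∂ α₀ Q ⟧ point~ * w̃)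
          ≈⟨ +-cong (+-congˡ (z*-raise (⟦⟧-cong n (∂ υ Q) points)))
               (z*-raise (Modulo.*-cong n (⟦⟧-cong n (∂ α₀ Q) points) w̃≈w)) ⟩
        F′ + z * ⟦ ∂ υ Q ⟧ point + z * (⟦ ∂ α₀ Q ⟧ point * w)
          ≈⟨ +-congˡ (solve 3 (λ z a w → z :* (a :* w) := z :* w :* a) refl _ _ _) ⟩
        F′ + z * ⟦ ∂ υ Q ⟧ point + z * w * ⟦ ∂ α₀ Q ⟧ point
          ≈⟨ w-equation (suc n) ⟨
        w ∎)
      where
      open Modulo (suc n)
      points : Pointwise (λ x y → x ≈[ n ] y) point~ point
      points = f̃≈f ∷ w̃≈w ∷ Modulo.refl n ∷ Modulo.refl n ∷ []

    kernelMethod : ∀ n → Σz (λ k → ι (atu=0 M k)) + U * w ≈[ n ] f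
    kernelMethod n = begin
      Σz (λ k → ι (atu=0 M k)) + U * w ≈⟨ +-congˡ (*-congˡ (proj₂ (substituted≈solution n))) ⟨
      Σz (λ k → ι (atu=0 M k)) + U * w̃ ≈⟨ S-divided n M ⟨
      f̃                                ≈⟨ proj₁ (substituted≈solution n) ⟩
      f                                ∎
      where open Modulo n

-- Formal power series as a z-adic ring.

module FormalPowerSeries {c ℓ} (A : CommutativeRing c ℓ) where
  private
    module A = CommutativeRing A
  open A using (_≈_; refl; sym; trans; +-cong; +-congˡ; +-congʳ; *-cong; *-congˡ; *-congʳ)
  open PowerSeries A.rawRing
  open RawRing ring using (_+_; _*_; -_; 0#; 1#)
  open SemiringSolver A.commutativeSemiring using (solve; _:=_; _:+_; _:*_)
  open SetoidReasoning A.setoid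

  -- Coefficient i of a product involves only coefficients up to i of the factors; this is what
  -- makes multiplication compatible with congruence modulo zⁿ.
  *-cong-upTo : ∀ i {f f′ g g′ : Series} → (∀ j → j ≤ i → f j ≈ f′ j) → (∀ j → j ≤ i → g j ≈ g′ j) →
                (f * g) i ≈ (f′ * g′) i
  *-cong-upTo zero    f≈f′ g≈g′ = +-congʳ (*-cong (f≈f′ 0 z≤n) (g≈g′ 0 z≤n))
  *-cong-upTo (suc i) f≈f′ g≈g′ = +-cong (*-cong (f≈f′ 0 z≤n) (g≈g′ (suc i) ≤-refl))
    (*-cong-upTo i (λ j j≤i → f≈f′ (suc j) (s≤s j≤i)) (λ j j≤i → g≈g′ j (m≤n⇒m≤1+n j≤i)))

  -- The convolution unfolds at its first term by definition. Splitting off the last term instead is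
  -- the mirror image, which commutativity requires.
  *-suc-last : ∀ i (f g : Series) → (f * g) (suc i) ≈ (f * tail g) i A.+ f (suc i) A.* g 0
  *-suc-last zero    f g = solve 3 (λ a b o → a :+ (b :+ o) := (a :+ o) :+ b) refl _ _ _
  *-suc-last (suc i) f g = trans (+-congˡ (*-suc-last i (tail f) g)) (sym (A.+-assoc _ _ _))

  *-comm : ∀ i (f g : Series) → (f * g) i ≈ (g * f) i
  *-comm zero    f g = +-congʳ (A.*-comm _ _)
  *-comm (suc i) f g = begin
    f 0 A.* g (suc i) A.+ (tail f * g) i ≈⟨ +-cong (A.*-comm _ _) (*-comm i (tail f) g) ⟩
    g (suc i) A.* f 0 A.+ (g * tail f) i ≈⟨ A.+-comm _ _ ⟩
    (g * tail f) i A.+ g (suc i) A.* f 0 ≈⟨ *-suc-last i g f ⟨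
    (g * f) (suc i)                      ∎

  *-distribʳ-+ : ∀ i (f g h : Series) → ((g + h) * f) i ≈ (g * f) i A.+ (h * f) i
  *-distribʳ-+ zero    f g h = trans (A.+-identityʳ _) (trans (A.distribʳ _ _ _)
    (sym (+-cong (A.+-identityʳ _) (A.+-identityʳ _))))
  *-distribʳ-+ (suc i) f g h = trans (+-congˡ (*-distribʳ-+ i f (tail g) (tail h)))
    (solve 5 (λ a b c s t → (a :+ b) :* c :+ (s :+ t) := (a :* c :+ s) :+ (b :* c :+ t)) refl _ _ _ _ _)

  *-scaleˡ : ∀ i a (f g : Series) → ((λ k → a A.* f k) * g) i ≈ a A.* (f * g) i
  *-scaleˡ zero    a f g = trans (A.+-identityʳ _) (trans (A.*-assoc _ _ _) (*-congˡ (sym (A.+-identityʳ _))))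
  *-scaleˡ (suc i) a f g = trans (+-congˡ (*-scaleˡ i a (tail f) g))
    (solve 4 (λ a b c s → a :* b :* c :+ a :* s := a :* (b :* c :+ s)) refl _ _ _ _)

  -- By computation the tail of f g is f₀ times the tail of g plus the tail of f times g;
  -- distributivity reduces the claim to the tail of f.
  *-assoc : ∀ i (f g h : Series) → ((f * g) * h) i ≈ (f * (g * h)) i
  *-assoc zero    f g h = +-congʳ (trans (*-congʳ (A.+-identityʳ _))
    (trans (A.*-assoc _ _ _) (*-congˡ (sym (A.+-identityʳ _)))))
  *-assoc (suc i) f g h = begin
    (f * g) 0 A.* h (suc i) A.+ (tail (f * g) * h) i
      ≈⟨ +-cong (*-congʳ (A.+-identityʳ _)) (*-distribʳ-+ i h (λ k → f 0 A.* g (suc k)) (tail f * g)) ⟩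
    f 0 A.* g 0 A.* h (suc i) A.+ (((λ k → f 0 A.* g (suc k)) * h) i A.+ ((tail f * g) * h) i)
      ≈⟨ +-congˡ (+-cong (*-scaleˡ i (f 0) (tail g) h) (*-assoc i (tail f) g h)) ⟩
    f 0 A.* g 0 A.* h (suc i) A.+ (f 0 A.* (tail g * h) i A.+ (tail f * (g * h)) i)
      ≈⟨ solve 5 (λ f g h s t → f :* g :* h :+ (f :* s :+ t) := f :* (g :* h :+ s) :+ t) refl _ _ _ _ _ ⟩
    f 0 A.* (g * h) (suc i) A.+ (tail f * (g * h)) i ∎

  -- Stated for the constantly zero function because the tail of `const a` reduces to exactly that.
  *-zeroˡ : ∀ i (g : Series) → ((λ _ → A.0#) * g) i ≈ A.0#
  *-zeroˡ zero    g = trans (A.+-identityʳ _) (A.zeroˡ _)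
  *-zeroˡ (suc i) g = trans (+-cong (A.zeroˡ _) (*-zeroˡ i g)) (A.+-identityʳ _)

  const-* : ∀ i a (g : Series) → (const a * g) i ≈ a A.* g i
  const-* zero    a g = A.+-identityʳ _
  const-* (suc i) a g = trans (+-congˡ (*-zeroˡ i g)) (A.+-identityʳ _)

  *-identityˡ : ∀ i (g : Series) → (1# * g) i ≈ g i
  *-identityˡ i g = trans (const-* i A.1# g) (A.*-identityˡ _)

  var-*-zero : ∀ (g : Series) → (var * g) 0 ≈ A.0#
  var-*-zero g = trans (A.+-identityʳ _) (A.zeroˡ _)

  var-*-suc : ∀ i (g : Series) → (var * g) (suc i) ≈ g i
  var-*-suc i g = begin
    -- The tail of `var` is the series 1 only after a case split on the index, hence the
    -- coefficientwise comparison.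
    A.0# A.* g (suc i) A.+ (tail var * g) i ≈⟨ +-cong (A.zeroˡ _) (*-cong-upTo i {g = g} {g′ = g} (λ j _ → tail-var j) (λ _ _ → refl)) ⟩
    A.0# A.+ (1# * g) i                     ≈⟨ trans (A.+-identityˡ _) (*-identityˡ i g) ⟩
    g i                                     ∎
    where
    tail-var : ∀ j → tail var j ≈ 1# j
    tail-var zero    = refl
    tail-var (suc j) = refl

  0#-zero : ∀ i → 0# i ≈ A.0#
  0#-zero zero    = refl
  0#-zero (suc i) = refl

  infix 4 _≈[_]_
  _≈[_]_ : Series → ℕ → Series → Set ℓ
  f ≈[ n ] g = ∀ i → i < n → f i ≈ g i

  isCommutativeRing : ∀ n → IsCommutativeRing (λ f g → f ≈[ n ] g) _+_ _*_ -_ 0# 1#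
  isCommutativeRing n = record
    { isRing = record
      { +-isAbelianGroup = record
        { isGroup = record
          { isMonoid = record
            { isSemigroup = record
              { isMagma = record
                { isEquivalence = record
                  { refl  = λ _ _ → refl
                  ; sym   = λ f≈g i i<n → sym (f≈g i i<n)
                  ; trans = λ f≈g g≈h i i<n → trans (f≈g i i<n) (g≈h i i<n)
                  }
                ; ∙-cong = λ f≈f′ g≈g′ i i<n → +-cong (f≈f′ i i<n) (g≈g′ i i<n)
                }
              ; assoc = λ f g h i _ → A.+-assoc _ _ _
              }
            ; identity = (λ f i _ → trans (+-congʳ (0#-zero i)) (A.+-identityˡ _))
                       , (λ f i _ → trans (+-congˡ (0#-zero i)) (A.+-identityʳ _))
            }
          ; inverse = (λ f i _ → trans (A.-‿inverseˡ _) (sym (0#-zero i)))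
                    , (λ f i _ → trans (A.-‿inverseʳ _) (sym (0#-zero i)))
          ; ⁻¹-cong = λ f≈g i i<n → A.-‿cong (f≈g i i<n)
          }
        ; comm = λ f g i _ → A.+-comm _ _
        }
      ; *-cong = λ f≈f′ g≈g′ i i<n → *-cong-upTo i
          (λ j j≤i → f≈f′ j (≤-<-trans j≤i i<n)) (λ j j≤i → g≈g′ j (≤-<-trans j≤i i<n))
      ; *-assoc = λ f g h i _ → *-assoc i f g h
      ; *-identity = (λ f i _ → *-identityˡ i f)
                   , (λ f i _ → trans (*-comm i f 1#) (*-identityˡ i f))
      ; distrib = (λ f g h i _ → trans (*-comm i f (g + h)) (trans (*-distribʳ-+ i f g h)
                                   (+-cong (*-comm i g f) (*-comm i h f))))
                , (λ f g h i _ → *-distribʳ-+ i f g h)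
      }
    ; *-comm = λ f g i _ → *-comm i f g
    }

  -- Coefficient i is the finite sum over k ≤ i of coefficient i - k of `x k`; the recursion mirrors
  -- the unfolding law.
  Σz : (ℕ → Series) → Series
  Σz x zero    = x 0 0
  Σz x (suc i) = x 0 (suc i) A.+ Σz (tail x) i

  -- Identifies the sum of the constants M(z,0)ₖ zᵏ produced by the kernel method with the series
  -- M(z,0) itself.
  Σz-const : ∀ (f : Series) i → Σz (λ k → const (f k)) i ≈ f i
  Σz-const f zero    = refl
  Σz-const f (suc i) = trans (A.+-identityˡ _) (Σz-const (tail f) i)

  adicRing : AdicRing c ℓ
  adicRing = record
    { rawRing           = ring
    ; _≈[_]_            = _≈[_]_
    ; isCommutativeRing = isCommutativeRing
    ; z                 = var
    ; Σz                = Σz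
    ; ≈[0]              = λ _ _ _ ()
    ; z*-raise          = raise
    ; Σz-unfold         = λ _ x i _ → unfold x i
    }
    where
    raise : ∀ {n f g} → f ≈[ n ] g → var * f ≈[ suc n ] var * g
    raise {f = f} {g} f≈g zero    _         = trans (var-*-zero f) (sym (var-*-zero g))
    raise {f = f} {g} f≈g (suc i) (s≤s i<n) = trans (var-*-suc i f) (trans (f≈g i i<n) (sym (var-*-suc i g)))
    unfold : ∀ x i → Σz x i ≈ x 0 i A.+ (var * Σz (tail x)) i
    unfold x zero    = sym (trans (+-congˡ (var-*-zero (Σz (tail x)))) (A.+-identityʳ _))
    unfold x (suc i) = +-congˡ (sym (var-*-suc i (Σz (tail x))))

  const-isHom : ∀ n → IsRingHomomorphism A.rawRing (CommutativeRing.rawRing (AdicRing.modulo adicRing n)) const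
  const-isHom n = record
    { isSemiringHomomorphism = record
      { isNearSemiringHomomorphism = record
        { +-isMonoidHomomorphism = record
          { isMagmaHomomorphism = record
            { isRelHomomorphism = record { cong = λ { a≈b zero _ → a≈b ; a≈b (suc i) _ → refl } }
            ; homo = λ { a b zero _ → refl ; a b (suc i) _ → sym (A.+-identityˡ _) }
            }
          ; ε-homo = λ _ _ → refl
          }
        ; *-homo = λ a b i _ → sym (trans (const-* i a (const b)) (scale-const a b i))
        }
      ; 1#-homo = λ _ _ → refl
      }
    ; -‿homo = λ { a zero _ → refl ; a (suc i) _ → sym -0#≈0# }
    }
    where
    open RingProperties A.ring using (-0#≈0#)
    scale-const : ∀ a b i → a A.* const b i ≈ const (a A.* b) i
    scale-const a b zero    = refl
    scale-const a b (suc i) = A.zeroʳ a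

-- The formula for M(z,0).

proposition2 : ∀ {c ℓ₁ ℓ₂} (K : OrderedCommutativeRing c ℓ₁ ℓ₂) →
    let open OrderedCommutativeRing K using (rawRing)
        open Catalytic rawRing
        open RawRing A[[z]].ring
    in
    (F₀ : MPoly 1) → NonNegative K 1 F₀ →
    (Q : MPoly 4) → NonNegative K 4 Q →
    NonZero 4 (∂ α₁ Q) →
    Nonlinear Q →
    (M : A[u][[z]].Series) → FunctionalEquation F₀ Q M →
    (f u w : A[[z]].Series) → System F₀ Q f u w →
    atu=0 M ≈ f + - (w * u)
proposition2 K F₀ _ Q _ _ _ M M-equation f u w system n = begin
  m n                            ≈⟨ +-identityʳ (m n) ⟨
  -- Adding and subtracting w u brings the left-hand side to the subtraction-free form M(z,0) + u w
  -- of `kernelMethod`.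
  m n + 0#                       ≈⟨ +-congˡ (-‿inverseʳ wu) ⟨
  m n + (wu + - wu)              ≈⟨ +-assoc _ _ _ ⟨
  (m n + wu) + - wu              ≈⟨ +-congʳ (+-cong (Σz-const m n) (*-comm n u w)) ⟨
  (Σz (λ k → const (m k)) n + (RawRing._*_ A[[z]].ring u w) n) + - wu
                                 -- The equations of the system are exact and so hold modulo every
                                 -- power of z; coefficient n is read off modulo zⁿ⁺¹.
                                 ≈⟨ +-congʳ (kernelMethod F₀ Q M M-equation f w
                                      (λ _ i _ → f-equation i) (λ _ i _ → u-equation i) (λ _ i _ → w-equation i)
                                      (suc n) n ≤-refl) ⟩
  f n + - wu                     ∎
  where
  open OrderedCommutativeRing K hiding (*-comm)
  open Catalytic rawRing
  open System system
  open A[[z]] using (const)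
  open FormalPowerSeries commutativeRing using (adicRing; const-isHom; Σz; Σz-const; *-comm)
  open Substitution commutativeRing adicRing const const-isHom u using (kernelMethod)
  open SetoidReasoning setoid
  m : A[[z]].Series
  m = atu=0 M
  wu : Carrier
  wu = RawRing._*_ A[[z]].ring w u n
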